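{- For every integer $k\ge 1$, the quantity $$\frac{n!\,k!\,(n+k+1)!}{(2n+2)!}\,F(2n+2k;\,0,\,n),$$ as a function of the integer $n\ge 0$, is given by a polynomial in $n$ with all coefficients integers and with leading term $2^{3k-2}n^{2k-2}$.
   Context: For integers $m\ge 0$ and $n_1,n_2$, $F(m;n_1,n_2)$ denotes the number of Gessel walks with exactly $m$ steps from $(0,0)$ to $(n_1,n_2)$: lattice walks starting at the origin, each of whose $m$ steps is one of West $(-1,0)$, North-East $(1,1)$, East $(1,0)$, South-West $(-1,-1)$, and which remain in the first quadrant $\{(i,j): i\ge 0, j\ge 0\}$. In particular $F(m;n_1,n_2)=0$ if $n_1<0$ or $n_2<0$, and $F(0;n_1,n_2)=1$ if $n_1=n_2=0$ and $0$ otherwise. -}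

module Defs where

open import Data.Integer.Base as ℤ using (ℤ; +_; 0ℤ; 1ℤ; -1ℤ)
import Data.Integer.Properties as ℤ
open import Data.List.Base
  using (List; []; _∷_; length; filter; cartesianProductWith)
open import Data.List.Relation.Unary.All using (All; all?)
open import Data.Nat.Base using (ℕ; zero; suc; _+_; _*_; _<_; _!)
open import Data.Nat.Properties using (_!≢0)
open import Data.Product.Base using (_×_; _,_)
open import Data.Product.Properties using (≡-dec)
open import Data.Rational.Base as ℚ using (ℚ)
open import Data.Vec.Base using (Vec; []; _∷_)
open import Relation.Binary.PropositionalEquality.Core using (_≡_; _≢_)
open import Relation.Nullary.Decidable.Core using (Dec; _×-dec_)

Point : Set
Point = ℤ × ℤ

data Step : Set where
  west northEast east southWest : Step

step : Step → Point
step west      = -1ℤ , 0ℤ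
step northEast = 1ℤ , 1ℤ
step east      = 1ℤ , 0ℤ
step southWest = -1ℤ , -1ℤ

infixl 6 _⊕_
_⊕_ : Point → Point → Point
(i , j) ⊕ (i′ , j′) = i ℤ.+ i′ , j ℤ.+ j′

origin : Point
origin = 0ℤ , 0ℤ

-- All points met from p on, both ends included.
visited : ∀ {m} → Point → Vec Step m → List Point
visited p []      = p ∷ []
visited p (s ∷ w) = p ∷ visited (p ⊕ step s) w

endpoint : ∀ {m} → Point → Vec Step m → Point
endpoint p []      = p
endpoint p (s ∷ w) = endpoint (p ⊕ step s) w

InQuadrant : Point → Set
InQuadrant (i , j) = 0ℤ ℤ.≤ i × 0ℤ ℤ.≤ j

inQuadrant? : ∀ p → Dec (InQuadrant p)
inQuadrant? (i , j) = (0ℤ ℤ.≤? i) ×-dec (0ℤ ℤ.≤? j)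

GesselWalk : ∀ {m} → Point → Vec Step m → Set
GesselWalk q w = All InQuadrant (visited origin w) × endpoint origin w ≡ q

gesselWalk? : ∀ {m} q (w : Vec Step m) → Dec (GesselWalk q w)
gesselWalk? q w =
  all? inQuadrant? (visited origin w) ×-dec
  ≡-dec ℤ._≟_ ℤ._≟_ (endpoint origin w) q

-- Every step sequence of length m occurs exactly once in this list.
stepSequences : ∀ m → List (Vec Step m)
stepSequences zero    = [] ∷ []
stepSequences (suc m) =
  cartesianProductWith _∷_ (west ∷ northEast ∷ east ∷ southWest ∷ [])
                           (stepSequences m)

F : ℕ → ℤ → ℤ → ℕ
F m n₁ n₂ = length (filter (gesselWalk? (n₁ , n₂)) (stepSequences m))

-- n! k! (n+k+1)! / (2n+2)! · F(2n+2k; 0, n)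
quantity : ℕ → ℕ → ℚ
quantity k n =
  ℚ._/_ (+ (n ! * k ! * (n + k + 1) !)) ((2 * n + 2) !) {{(2 * n + 2) !≢0}}
    ℚ.* ((+ F (2 * n + 2 * k) 0ℤ (+ n)) ℚ./ 1)

-- Integer polynomials as coefficient lists, constant term first;
-- trailing zeros are allowed.
Polynomial : Set
Polynomial = List ℤ

coeff : Polynomial → ℕ → ℤ
coeff []      _       = 0ℤ
coeff (a ∷ p) zero    = a
coeff (a ∷ p) (suc i) = coeff p i

eval : Polynomial → ℤ → ℤ
eval []      x = 0ℤ
eval (a ∷ p) x = a ℤ.+ x ℤ.* eval p x

-- The leading term of p is c · x ^ d.
HasLeadingTerm : Polynomial → ℤ → ℕ → Set
HasLeadingTerm p c d =
  coeff p d ≡ c × c ≢ 0ℤ × (∀ i → d < i → coeff p i ≡ 0ℤ)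

{-# OPTIONS --safe #-}
module Submission where

-- Put s = n + 1 and shift the plane up by one, so that walks go from (0, 1) to
-- (0, s) and must avoid the wall y = 0.  A walk with 2 n + 2 k steps has exactly
-- k steps East or South-West.  Without the wall the number of walks from (i, y)
-- to (0, s) with κ such steps in a total of m is a ballot number times C(m, κ).
-- A walk is discarded at its first visit to the wall, say at (i, 0) with κ steps
-- East or South-West left; these events do not depend on n, there are finitely
-- many, and i + κ < k.  Multiplied by s! k! (s + k)! / (2 s)!, each half-plane
-- count becomes a product of integer linear factors in s: of degree 2 k - 1 with
-- leading coefficient 2 ^ (3 k - 2) for the start, of smaller degree for the
-- discarded walks.  The difference vanishes at s = 0, where the goal lies on the
-- wall, hence is divisible by s = n + 1, and the quotient is the quantity.

open import Data.Integer.Base as ℤ using (ℤ; +_; 0ℤ; 1ℤ)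
import Data.Integer.Properties as ℤ
import Data.Integer.Tactic.RingSolver as ℤ-Solver
open import Data.List.Base using ([]; _∷_; _++_; length; filter; map)
open import Data.List.Properties using (filter-++; length-++; filter-none; filter-accept)
open import Data.List.Relation.Unary.All as All using (All; []; _∷_; all?)
open import Data.Nat.Base hiding (_/_)
open import Data.Nat.Combinatorics
  using (_C_; nCk+nC[k+1]≡[n+1]C[k+1]; k>n⇒nCk≡0; nCk≡nC[n∸k]; nCn≡1; nCk≡n!/k![n-k]!; k![n∸k]!∣n!)
open import Data.Nat.DivMod using (m/n*n≡m)
open import Data.Nat.Properties
open import Data.Nat.Tactic.RingSolver using (solve-∀)
open import Data.Product.Base using (Σ; _×_; _,_)
open import Data.Product.Properties using (≡-dec)
open import Data.Rational.Base as ℚ using (_/_)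
import Data.Rational.Properties as ℚ
import Data.Rational.Unnormalised.Base as ℚᵘ
import Data.Rational.Unnormalised.Properties as ℚᵘ
open import Data.Vec.Base using (Vec; []; _∷_; _∷ʳ_; zipWith)
open import Level using (0ℓ)
open import Relation.Binary.PropositionalEquality
open import Relation.Nullary.Decidable.Core using (Dec; yes; no; _×-dec_)
open import Relation.Nullary.Negation.Core using (¬_; contradiction)
open import Relation.Unary using (Pred; Decidable)
open import Defs
open ≡-Reasoning

-- Walks with and without the wall

before : (ℕ → ℕ) → ℕ → ℕ
before f zero    = 0
before f (suc i) = f i

-- Paths of `m` steps +1 or -1 from `i` to 0 that never go below 0: the projections of the walks to
-- the first coordinate.
ballot : ℕ → ℕ → ℕ
ballot zero    zero    = 1
ballot zero    (suc i) = 0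
ballot (suc m) i       = ballot m (suc i) + before (ballot m) i

-- Walks with m steps left that stay in i ≥ 0 and are to reach i = 0, where κ of
-- the steps left are East or South-West.
halfPlane : ℕ → ℕ → ℕ → ℕ
halfPlane m i κ = ballot m i * (m C κ)

-- The four summands are North-East, West, East and South-West.
advance : (ℕ → ℕ → ℕ → ℕ) → ℕ → ℕ → ℕ → ℕ
advance W i y κ =
  W (suc i) (2 + y) κ + before (λ i′ → W i′ (suc y) κ) i +
  before (λ κ′ → W (suc i) (suc y) κ′ + before (λ i′ → W i′ y κ′) i) κ

-- The final height s is no argument: each step preserves m + 2 y - i - 2 κ, and at m = i = κ = 0
-- this is twice the final height. So the other arguments determine s, and the goal only has to ask
-- for i = κ = 0.
walks : (wall : ℕ → ℕ → ℕ → ℕ) (goal : ℕ → ℕ → ℕ) →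
        ℕ → ℕ → ℕ → ℕ → ℕ
walks wall goal m       i zero    κ = wall m i κ
walks wall goal zero    i (suc y) κ = goal i κ
walks wall goal (suc m) i (suc y) κ = advance (walks wall goal m) i y κ

atOrigin : ℕ → ℕ → ℕ
atOrigin zero    zero    = 1
atOrigin zero    (suc _) = 0
atOrigin (suc _) _       = 0

avoiding : ℕ → ℕ → ℕ → ℕ → ℕ
avoiding = walks (λ _ _ _ → 0) atOrigin

hitting : ℕ → ℕ → ℕ → ℕ → ℕ
hitting = walks halfPlane (λ _ _ → 0)

nC0≡1 : ∀ n → n C 0 ≡ 1
nC0≡1 n = trans (nCk≡nC[n∸k] {0} {n} z≤n) (nCn≡1 n)

pascal : ∀ n k → suc n C k ≡ n C k + before (n C_) k
pascal n zero    = trans (nC0≡1 (suc n)) (sym (trans (+-identityʳ (n C 0)) (nC0≡1 n)))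
pascal n (suc k) = trans (sym (nCk+nC[k+1]≡[n+1]C[k+1] n k)) (+-comm (n C k) (n C suc k))

halfPlane-goal : ∀ i κ → halfPlane 0 i κ ≡ atOrigin i κ
halfPlane-goal zero    zero    = refl
halfPlane-goal zero    (suc κ) = trans (+-identityʳ _) (k>n⇒nCk≡0 {0} {suc κ} z<s)
halfPlane-goal (suc i) κ       = refl

-- Each of the two changes of i is made by exactly one step of the pair East, South-West and exactly
-- one of the pair West, North-East. The path of i and the set of κ positions are therefore chosen
-- independently, and the ballot recurrence times Pascal's rule gives the four summands.
halfPlane-step : ∀ m i y κ →
  halfPlane (suc m) i κ ≡ advance (λ i _ κ → halfPlane m i κ) i y κ
halfPlane-step m i y κ rewrite pascal m κ with i | κ
... | zero  | zero  = lemma (ballot m 1) (m C 0)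
  where
  lemma : ∀ a c → (a + 0) * (c + 0) ≡ a * c + 0 + 0
  lemma = solve-∀
... | zero  | suc l = lemma (ballot m 1) (m C suc l) (m C l)
  where
  lemma : ∀ a c d → (a + 0) * (c + d) ≡ a * c + 0 + (a * d + 0)
  lemma = solve-∀
... | suc j | zero  = lemma (ballot m (2 + j)) (ballot m j) (m C 0)
  where
  lemma : ∀ a b c → (a + b) * (c + 0) ≡ a * c + b * c + 0
  lemma = solve-∀
... | suc j | suc l = lemma (ballot m (2 + j)) (ballot m j) (m C suc l) (m C l)
  where
  lemma : ∀ a b c d → (a + b) * (c + d) ≡ a * c + b * c + (a * d + b * d)
  lemma = solve-∀

advance-+ : ∀ {U V W} → (∀ i y κ → U i y κ + V i y κ ≡ W i y κ) →
            ∀ i y κ → advance U i y κ + advance V i y κ ≡ advance W i y κ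
advance-+ {U} {V} {W} U+V≡W i y κ = begin
  advance U i y κ + advance V i y κ
    ≡⟨ interchange₃ (U (suc i) (2 + y) κ) (before (λ i′ → U i′ (suc y) κ) i) _
                    (V (suc i) (2 + y) κ) _ _ ⟩
  _ ≡⟨ cong₂ _+_
         (cong₂ _+_ (U+V≡W (suc i) (2 + y) κ) (before-+ (λ i′ → U+V≡W i′ (suc y) κ) i))
         (before-+ (λ κ′ → trans
            (interchange₂ (U (suc i) (suc y) κ′) _ (V (suc i) (suc y) κ′) _)
            (cong₂ _+_ (U+V≡W (suc i) (suc y) κ′) (before-+ (λ i′ → U+V≡W i′ y κ′) i))) κ) ⟩
  advance W i y κ ∎
  where
  before-+ : ∀ {f g h} → (∀ x → f x + g x ≡ h x) → ∀ i → before f i + before g i ≡ before h i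
  before-+ f+g≡h zero    = refl
  before-+ f+g≡h (suc i) = f+g≡h i
  interchange₃ : ∀ a b c a′ b′ c′ → (a + b + c) + (a′ + b′ + c′) ≡ (a + a′) + (b + b′) + (c + c′)
  interchange₃ = solve-∀
  interchange₂ : ∀ a b a′ b′ → (a + b) + (a′ + b′) ≡ (a + a′) + (b + b′)
  interchange₂ = solve-∀

-- All three counts obey the same linear recurrence off the wall, so only the boundary values
-- matter: on the wall everything is `hitting`, at the goal everything is `avoiding`.
avoiding+hitting : ∀ m i y κ → avoiding m i y κ + hitting m i y κ ≡ halfPlane m i κ
avoiding+hitting m       i zero    κ = refl
avoiding+hitting zero    i (suc y) κ = trans (+-identityʳ _) (sym (halfPlane-goal i κ))
avoiding+hitting (suc m) i (suc y) κ =
  trans (advance-+ {avoiding m} {hitting m} (avoiding+hitting m) i y κ) (sym (halfPlane-step m i y κ))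

zero-sum : ∀ {a b c} → a ≡ 0 → b ≡ 0 → c ≡ 0 → a + b + c ≡ 0
zero-sum refl refl refl = refl

-- The wall costs y South-West steps, each undone in i by an East or North-East.
hitting-zero : ∀ m i y κ → i + 2 * κ < 3 * y → hitting m i y κ ≡ 0
hitting-zero zero    i (suc y) κ lt = refl
hitting-zero (suc m) i (suc y) κ lt = zero-sum
  (hitting-zero m (suc i) (2 + y) κ (≤-<-trans lt (*-monoʳ-< 3 (n<1+n (suc y)))))
  (goWest i lt)
  (consume i κ lt)
  where
  goWest : ∀ i → i + 2 * κ < 3 * suc y → before (λ i′ → hitting m i′ (suc y) κ) i ≡ 0
  goWest zero     lt = refl
  goWest (suc i′) lt = hitting-zero m i′ (suc y) κ (<-trans (n<1+n _) lt)
  goSouthWest : ∀ i κ → i + 2 * suc κ < 3 * suc y → before (λ i′ → hitting m i′ y κ) i ≡ 0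
  goSouthWest zero     κ lt = refl
  goSouthWest (suc i′) κ lt = hitting-zero m i′ y κ
    (+-cancelˡ-< 3 _ _ (subst₂ _<_ (lemma₁ i′ κ) (lemma₂ y) lt))
    where
    lemma₁ : ∀ i κ → suc i + 2 * suc κ ≡ 3 + (i + 2 * κ)
    lemma₁ = solve-∀
    lemma₂ : ∀ y → 3 * suc y ≡ 3 + 3 * y
    lemma₂ = solve-∀
  consume : ∀ i κ → i + 2 * κ < 3 * suc y →
    before (λ κ′ → hitting m (suc i) (suc y) κ′ + before (λ i′ → hitting m i′ y κ′) i) κ ≡ 0
  consume i zero     lt = refl
  consume i (suc κ′) lt = cong₂ _+_
    (hitting-zero m (suc i) (suc y) κ′ (<-trans (≤-reflexive (lemma i κ′)) lt))
    (goSouthWest i κ′ lt)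
    where
    lemma : ∀ i κ → suc (suc i + 2 * κ) ≡ i + 2 * suc κ
    lemma = solve-∀

-- Under this hypothesis the goal lies on or below the wall.
avoiding-zero : ∀ m i y κ → m + 2 * y ≤ i + 2 * κ → avoiding m i y κ ≡ 0
avoiding-zero m       i       zero    κ       le = refl
avoiding-zero zero    zero    (suc y) zero    ()
avoiding-zero zero    zero    (suc y) (suc κ) le = refl
avoiding-zero zero    (suc i) (suc y) κ       le = refl
avoiding-zero (suc m) i       (suc y) κ       le = zero-sum
  (avoiding-zero m (suc i) (2 + y) κ
    (subst (_≤ suc (i + 2 * κ)) (lemma m y) (s≤s le)))
  (goWest i le)
  (consume i κ le)
  where
  lemma : ∀ m y → suc (suc m + 2 * suc y) ≡ m + 2 * (2 + y)
  lemma = solve-∀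
  goWest : ∀ i → suc m + 2 * suc y ≤ i + 2 * κ → before (λ i′ → avoiding m i′ (suc y) κ) i ≡ 0
  goWest zero     le = refl
  goWest (suc i′) le = avoiding-zero m i′ (suc y) κ (s≤s⁻¹ le)
  goSouthWest : ∀ i κ → suc m + 2 * suc y ≤ i + 2 * suc κ → before (λ i′ → avoiding m i′ y κ) i ≡ 0
  goSouthWest zero     κ le = refl
  goSouthWest (suc i′) κ le = avoiding-zero m i′ y κ
    (+-cancelˡ-≤ 3 _ _ (subst₂ _≤_ (lemma₁ m y) (lemma₁ i′ κ) le))
    where
    lemma₁ : ∀ i κ → suc i + 2 * suc κ ≡ 3 + (i + 2 * κ)
    lemma₁ = solve-∀
  consume : ∀ i κ → suc m + 2 * suc y ≤ i + 2 * κ →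
    before (λ κ′ → avoiding m (suc i) (suc y) κ′ + before (λ i′ → avoiding m i′ y κ′) i) κ ≡ 0
  consume i zero     le = refl
  consume i (suc κ′) le = cong₂ _+_
    (avoiding-zero m (suc i) (suc y) κ′ (s≤s⁻¹ (≤-trans le (≤-reflexive (lemma₁ i κ′)))))
    (goSouthWest i κ′ le)
    where
    lemma₁ : ∀ i κ → i + 2 * suc κ ≡ suc (suc i + 2 * κ)
    lemma₁ = solve-∀

-- Closed forms of ballot numbers and binomial coefficients

ballot-zero : ∀ {m i} → m < i → ballot m i ≡ 0
ballot-zero {zero}  {suc i} lt = refl
ballot-zero {suc m} {suc i} lt = cong₂ _+_
  (ballot-zero (<-trans (n<1+n m) (<-trans lt (n<1+n (suc i))))) (ballot-zero (s≤s⁻¹ lt))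

-- The ballot theorem, (i + 1) / (m + 1) times C(m + 1, u), with denominators cleared; `u` is the
-- number of steps +1. The formula satisfies the recurrence of `ballot`.
ballot-closed : ∀ m u i → m ≡ i + 2 * u → ballot m i * (u ! * suc (i + u) !) ≡ suc i * m !
ballot-closed zero    zero    zero    eq = refl
-- With `u = 0` the path can only descend: from `2 + i` there are too few steps left.
ballot-closed (suc m) zero    (suc i) eq = begin
  (ballot m (2 + i) + ballot m i) * (1 * ((2 + (i + 0)) * suc (i + 0) !))
    ≡⟨ cong₂ (λ b x → (b + ballot m i) * (1 * ((2 + x) * suc (i + 0) !)))
         (ballot-zero (≤-trans (≤-reflexive (cong suc m≡i)) (n≤1+n (suc i)))) (+-identityʳ i) ⟩
  ballot m i * (1 * ((2 + i) * suc (i + 0) !))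
    ≡⟨ lemma (ballot m i) (2 + i) (suc (i + 0) !) ⟩
  (2 + i) * (ballot m i * (1 * suc (i + 0) !))
    ≡⟨ cong ((2 + i) *_) (ballot-closed m zero i (suc-injective eq)) ⟩
  (2 + i) * (suc i * m !)
    ≡⟨ cong (λ x → (2 + i) * (suc x * m !)) m≡i ⟨
  (2 + i) * (suc m * m !) ∎
  where
  m≡i : m ≡ i
  m≡i = trans (suc-injective eq) (+-identityʳ i)
  lemma : ∀ b x y → b * (1 * (x * y)) ≡ x * (b * (1 * y))
  lemma = solve-∀
ballot-closed (suc m) (suc u) zero    eq = begin
  (ballot m 1 + 0) * (suc u * u ! * (2 + u) !)
    ≡⟨ lemma₁ (ballot m 1) (suc u) (u !) ((2 + u) !) ⟩
  suc u * (ballot m 1 * (u ! * (2 + u) !))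
    ≡⟨ cong (suc u *_) (ballot-closed m u 1 m≡1+2u) ⟩
  suc u * (2 * m !)
    ≡⟨ lemma₂ u (m !) ⟩
  1 * (suc (1 + 2 * u) * m !)
    ≡⟨ cong (λ x → 1 * (suc x * m !)) m≡1+2u ⟨
  1 * (suc m * m !) ∎
  where
  m≡1+2u : m ≡ 1 + 2 * u
  m≡1+2u = trans (suc-injective eq) (+-suc u (u + 0))
  lemma₁ : ∀ b x y z → (b + 0) * (x * y * z) ≡ x * (b * (y * z))
  lemma₁ = solve-∀
  lemma₂ : ∀ u x → suc u * (2 * x) ≡ 1 * (suc (1 + 2 * u) * x)
  lemma₂ = solve-∀
ballot-closed (suc m) (suc u) (suc i) eq
  rewrite +-suc i u = begin
  (ballot m (2 + i) + ballot m i) * (suc u * u ! * ((3 + i + u) * (2 + i + u) !))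
    ≡⟨ lemma₁ (ballot m (2 + i)) (ballot m i) u i (u !) ((2 + i + u) !) ⟩
  suc u * (ballot m (2 + i) * (u ! * (3 + i + u) !)) +
  (3 + i + u) * (ballot m i * (suc u ! * (2 + i + u) !))
    ≡⟨ cong₂ (λ x y → suc u * x + (3 + i + u) * y)
         (ballot-closed m u (2 + i) m≡2+i+2u)
         (trans (cong (λ x → ballot m i * (suc u ! * suc x !)) (sym (+-suc i u)))
                (ballot-closed m (suc u) i (suc-injective eq))) ⟩
  suc u * ((3 + i) * m !) + (3 + i + u) * (suc i * m !)
    ≡⟨ lemma₂ u i (m !) ⟩
  (2 + i) * (suc (2 + i + 2 * u) * m !)
    ≡⟨ cong (λ x → (2 + i) * (suc x * m !)) m≡2+i+2u ⟨
  (2 + i) * (suc m * m !) ∎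
  where
  m≡2+i+2u : m ≡ 2 + i + 2 * u
  m≡2+i+2u = trans (suc-injective eq) (lemma i u)
    where
    lemma : ∀ i u → i + 2 * suc u ≡ 2 + i + 2 * u
    lemma = solve-∀
  lemma₁ : ∀ a b u i x y → (a + b) * (suc u * x * ((3 + i + u) * y)) ≡
    suc u * (a * (x * ((3 + i + u) * y))) + (3 + i + u) * (b * (suc u * x * y))
  lemma₁ = solve-∀
  lemma₂ : ∀ u i x → suc u * ((3 + i) * x) + (3 + i + u) * (suc i * x) ≡
    (2 + i) * (suc (2 + i + 2 * u) * x)
  lemma₂ = solve-∀

choose-factorial : ∀ k j → ((j + k) C k) * k ! * j ! ≡ (j + k) !
choose-factorial k j = begin
  ((j + k) C k) * k ! * j !
    ≡⟨ *-assoc ((j + k) C k) (k !) (j !) ⟩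
  ((j + k) C k) * (k ! * j !)
    ≡⟨ cong (λ x → ((j + k) C k) * (k ! * x !)) (m+n∸n≡m j k) ⟨
  ((j + k) C k) * (k ! * (j + k ∸ k) !)
    ≡⟨ cong (_* (k ! * (j + k ∸ k) !)) (nCk≡n!/k![n-k]! (m≤n+m k j)) ⟩
  _ ≡⟨ m/n*n≡m {{k !* (j + k ∸ k) !≢0}} (k![n∸k]!∣n! (m≤n+m k j)) ⟩
  (j + k) ! ∎

-- Products of linear factors

rising : ℕ → ℕ → ℕ
rising x zero    = 1
rising x (suc r) = rising x r * suc (r + x)

rising-factorial : ∀ x r → (r + x) ! ≡ rising x r * x !
rising-factorial x zero    = sym (+-identityʳ (x !))
rising-factorial x (suc r) = begin
  suc (r + x) * (r + x) !           ≡⟨ cong (suc (r + x) *_) (rising-factorial x r) ⟩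
  suc (r + x) * (rising x r * x !)  ≡⟨ lemma (suc (r + x)) (rising x r) (x !) ⟩
  rising x r * suc (r + x) * x !    ∎
  where
  lemma : ∀ a b c → a * (b * c) ≡ b * a * c
  lemma = solve-∀

choose-rising : ∀ j k → ((j + k) C k) * k ! ≡ rising j k
choose-rising j k = *-cancelʳ-≡ _ _ (j !) {{j !≢0}}
  (trans (choose-factorial k j) (trans (cong _! (+-comm j k)) (rising-factorial j k)))

-- The falling factorial with k + 1 factors from j + k ends at j itself. The case `j = 0`, where
-- both sides vanish, does arise: `j` will be 2 s + k.
choose-rising-suc : ∀ j k → ((j + k) C suc k) * suc k ! ≡ rising j k * j
choose-rising-suc zero    k = trans (cong (_* suc k !) (k>n⇒nCk≡0 (n<1+n k))) (sym (*-zeroʳ (rising 0 k)))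
choose-rising-suc (suc j) k = *-cancelʳ-≡ _ _ (j !) {{j !≢0}} (begin
  (suc (j + k) C suc k) * suc k ! * j !
    ≡⟨ cong (λ x → (x C suc k) * suc k ! * j !) (+-suc j k) ⟨
  ((j + suc k) C suc k) * suc k ! * j !
    ≡⟨ choose-factorial (suc k) j ⟩
  (j + suc k) !
    ≡⟨ cong _! (trans (+-suc j k) (+-comm (suc j) k)) ⟩
  (k + suc j) !
    ≡⟨ rising-factorial (suc j) k ⟩
  rising (suc j) k * (suc j * j !)
    ≡⟨ *-assoc (rising (suc j) k) (suc j) (j !) ⟨
  rising (suc j) k * suc j * j ! ∎)

-- (2 (κ + s))! s! / ((2 s)! (κ + s)!)
doubling : ℕ → ℕ → ℕ
doubling s zero    = 1
doubling s (suc κ) = doubling s κ * (4 * s + (4 * κ + 2))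

-- With x = κ + s, the two new factors (2 x + 2) (2 x + 1) equal (4 x + 2) (x + 1): one factor for
-- `doubling`, one for the factorial on the right.
doubling-factorial : ∀ s κ → s ! * (2 * (κ + s)) ! ≡ doubling s κ * (2 * s) ! * (κ + s) !
doubling-factorial s zero    = lemma (s !) ((2 * s) !)
  where
  lemma : ∀ a b → a * b ≡ 1 * b * a
  lemma = solve-∀
doubling-factorial s (suc κ) = begin
  s ! * (2 * suc (κ + s)) !
    ≡⟨ cong (λ x → s ! * x !) (double-suc (κ + s)) ⟩
  s ! * ((2 + 2 * (κ + s)) * ((1 + 2 * (κ + s)) * (2 * (κ + s)) !))
    ≡⟨ lemma₁ (s !) s κ ((2 * (κ + s)) !) ⟩
  (4 * s + (4 * κ + 2)) * suc (κ + s) * (s ! * (2 * (κ + s)) !)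
    ≡⟨ cong ((4 * s + (4 * κ + 2)) * suc (κ + s) *_) (doubling-factorial s κ) ⟩
  (4 * s + (4 * κ + 2)) * suc (κ + s) * (doubling s κ * (2 * s) ! * (κ + s) !)
    ≡⟨ lemma₂ (4 * s + (4 * κ + 2)) (suc (κ + s)) (doubling s κ) ((2 * s) !) ((κ + s) !) ⟩
  doubling s κ * (4 * s + (4 * κ + 2)) * (2 * s) ! * (suc (κ + s) * (κ + s) !) ∎
  where
  double-suc : ∀ x → 2 * suc x ≡ 2 + 2 * x
  double-suc = solve-∀
  lemma₁ : ∀ a s κ b → a * ((2 + 2 * (κ + s)) * ((1 + 2 * (κ + s)) * b)) ≡
                       (4 * s + (4 * κ + 2)) * suc (κ + s) * (a * b)
  lemma₁ = solve-∀
  lemma₂ : ∀ a b x y z → a * b * (x * y * z) ≡ x * a * y * (b * z)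
  lemma₂ = solve-∀

-- Polynomials with a tracked top coefficient

-- Keeping the top coefficient apart from the `d` lower ones lets the types carry degree and leading
-- coefficient while the lower coefficients stay anonymous.
withLeading : ∀ {d} → Vec ℤ d → ℤ → Polynomial
withLeading []      c = c ∷ []
withLeading (a ∷ v) c = a ∷ withLeading v c

coeff-leading : ∀ {d} (v : Vec ℤ d) c → coeff (withLeading v c) d ≡ c
coeff-leading []      c = refl
coeff-leading (a ∷ v) c = coeff-leading v c

coeff-above : ∀ {d} (v : Vec ℤ d) c i → d < i → coeff (withLeading v c) i ≡ 0ℤ
coeff-above []      c (suc i) lt = refl
coeff-above (a ∷ v) c (suc i) lt = coeff-above v c i (s≤s⁻¹ lt)

-- The lower coefficients of (b + a x) p; the new top coefficient is `a ℤ.* c`.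
mulLinear : ∀ {d} (b a : ℤ) → Vec ℤ d → ℤ → Vec ℤ (suc d)
mulLinear b a []      c = b ℤ.* c ∷ []
mulLinear b a (x ∷ v) c with mulLinear b a v c
... | y ∷ w = b ℤ.* x ∷ (a ℤ.* x ℤ.+ y) ∷ w

eval-mulLinear : ∀ {d} b a (v : Vec ℤ d) c x →
  eval (withLeading (mulLinear b a v c) (a ℤ.* c)) x ≡ (b ℤ.+ a ℤ.* x) ℤ.* eval (withLeading v c) x
eval-mulLinear b a []      c x = lemma b a c x
  where
  lemma : ∀ b a c x → b ℤ.* c ℤ.+ x ℤ.* (a ℤ.* c ℤ.+ x ℤ.* 0ℤ) ≡ (b ℤ.+ a ℤ.* x) ℤ.* (c ℤ.+ x ℤ.* 0ℤ)
  lemma = ℤ-Solver.solve-∀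
eval-mulLinear b a (z ∷ v) c x with mulLinear b a v c | eval-mulLinear b a v c x
... | y ∷ w | ih = begin
  b ℤ.* z ℤ.+ x ℤ.* ((a ℤ.* z ℤ.+ y) ℤ.+ x ℤ.* eval (withLeading w (a ℤ.* c)) x)
    ≡⟨ lemma₁ b z x a y (eval (withLeading w (a ℤ.* c)) x) ⟩
  (b ℤ.+ a ℤ.* x) ℤ.* z ℤ.+ x ℤ.* (y ℤ.+ x ℤ.* eval (withLeading w (a ℤ.* c)) x)
    ≡⟨ cong (λ e → (b ℤ.+ a ℤ.* x) ℤ.* z ℤ.+ x ℤ.* e) ih ⟩
  (b ℤ.+ a ℤ.* x) ℤ.* z ℤ.+ x ℤ.* ((b ℤ.+ a ℤ.* x) ℤ.* eval (withLeading v c) x)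
    ≡⟨ lemma₂ (b ℤ.+ a ℤ.* x) z x (eval (withLeading v c) x) ⟩
  (b ℤ.+ a ℤ.* x) ℤ.* (z ℤ.+ x ℤ.* eval (withLeading v c) x) ∎
  where
  lemma₁ : ∀ b z x a y e → b ℤ.* z ℤ.+ x ℤ.* ((a ℤ.* z ℤ.+ y) ℤ.+ x ℤ.* e) ≡
                           (b ℤ.+ a ℤ.* x) ℤ.* z ℤ.+ x ℤ.* (y ℤ.+ x ℤ.* e)
  lemma₁ = ℤ-Solver.solve-∀
  lemma₂ : ∀ l z x e → l ℤ.* z ℤ.+ x ℤ.* (l ℤ.* e) ≡ l ℤ.* (z ℤ.+ x ℤ.* e)
  lemma₂ = ℤ-Solver.solve-∀

-- The lower coefficients of p(1 + x) by Horner's rule; the top one stays `c`.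
translate : ∀ {d} → Vec ℤ d → ℤ → Vec ℤ d
translate []      c = []
translate (a ∷ v) c with mulLinear 1ℤ 1ℤ (translate v c) c
... | y ∷ w = (a ℤ.+ y) ∷ w

eval-translate : ∀ {d} (v : Vec ℤ d) c x →
  eval (withLeading (translate v c) c) x ≡ eval (withLeading v c) (1ℤ ℤ.+ x)
eval-translate []      c x = lemma c x
  where
  lemma : ∀ c x → c ℤ.+ x ℤ.* 0ℤ ≡ c ℤ.+ (1ℤ ℤ.+ x) ℤ.* 0ℤ
  lemma = ℤ-Solver.solve-∀
eval-translate (a ∷ v) c x
  with mulLinear 1ℤ 1ℤ (translate v c) c | eval-mulLinear 1ℤ 1ℤ (translate v c) c x
... | y ∷ w | mul = begin
  a ℤ.+ y ℤ.+ x ℤ.* eval (withLeading w c) x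
    ≡⟨ ℤ.+-assoc a y _ ⟩
  a ℤ.+ (y ℤ.+ x ℤ.* eval (withLeading w c) x)
    ≡⟨ cong (λ l → a ℤ.+ (y ℤ.+ x ℤ.* eval (withLeading w l) x)) (ℤ.*-identityˡ c) ⟨
  a ℤ.+ (y ℤ.+ x ℤ.* eval (withLeading w (1ℤ ℤ.* c)) x)
    ≡⟨ cong (λ e → a ℤ.+ e) mul ⟩
  a ℤ.+ (1ℤ ℤ.+ 1ℤ ℤ.* x) ℤ.* eval (withLeading (translate v c) c) x
    ≡⟨ cong₂ (λ y e → a ℤ.+ (1ℤ ℤ.+ y) ℤ.* e) (ℤ.*-identityˡ x) (eval-translate v c x) ⟩
  a ℤ.+ (1ℤ ℤ.+ x) ℤ.* eval (withLeading v c) (1ℤ ℤ.+ x) ∎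

-- c is the coefficient at d and may vanish.
IsPoly : ℕ → ℕ → (ℕ → ℕ) → Set
IsPoly d c f = Σ (Vec ℤ d) λ v → ∀ s → + f s ≡ eval (withLeading v (+ c)) (+ s)

poly-cong : ∀ {d c f g} → (∀ s → f s ≡ g s) → IsPoly d c f → IsPoly d c g
poly-cong f≗g (v , eq) = v , λ s → trans (cong +_ (sym (f≗g s))) (eq s)

poly-leading : ∀ {d c c′ f} → c ≡ c′ → IsPoly d c f → IsPoly d c′ f
poly-leading refl p = p

poly-const : ∀ c → IsPoly 0 c (λ _ → c)
poly-const c = [] , λ s → sym (trans (cong (λ z → + c ℤ.+ z) (ℤ.*-zeroʳ (+ s))) (ℤ.+-identityʳ (+ c)))

poly-+ : ∀ {d a b f g} → IsPoly d a f → IsPoly d b g → IsPoly d (a + b) (λ s → f s + g s)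
poly-+ {f = f} {g} (v , f≡) (w , g≡) = zipWith ℤ._+_ v w , λ s →
  trans (ℤ.pos-+ (f s) (g s)) (trans (cong₂ ℤ._+_ (f≡ s) (g≡ s)) (sym (eval-+ v w (+ s))))
  where
  eval-+ : ∀ {d a b} (v w : Vec ℤ d) x → eval (withLeading (zipWith ℤ._+_ v w) (+ (a + b))) x ≡
           eval (withLeading v (+ a)) x ℤ.+ eval (withLeading w (+ b)) x
  eval-+ {a = a} {b} [] [] x = lemma (+ a) (+ b) x
    where
    lemma : ∀ a b x → a ℤ.+ b ℤ.+ x ℤ.* 0ℤ ≡ a ℤ.+ x ℤ.* 0ℤ ℤ.+ (b ℤ.+ x ℤ.* 0ℤ)
    lemma = ℤ-Solver.solve-∀
  eval-+ (a ∷ v) (b ∷ w) x = trans (cong (λ e → a ℤ.+ b ℤ.+ x ℤ.* e) (eval-+ v w x)) (lemma a b x _ _)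
    where
    lemma : ∀ a b x e f → a ℤ.+ b ℤ.+ x ℤ.* (e ℤ.+ f) ≡ a ℤ.+ x ℤ.* e ℤ.+ (b ℤ.+ x ℤ.* f)
    lemma = ℤ-Solver.solve-∀

poly-suc : ∀ {d c f} → IsPoly d c f → IsPoly (suc d) 0 f
poly-suc {c = c} (v , f≡) = v ∷ʳ + c , λ s → trans (f≡ s) (eval-∷ʳ v (+ c) (+ s))
  where
  eval-∷ʳ : ∀ {d} (v : Vec ℤ d) c x → eval (withLeading v c) x ≡ eval (withLeading (v ∷ʳ c) 0ℤ) x
  eval-∷ʳ []      c x = lemma c x
    where
    lemma : ∀ c x → c ℤ.+ x ℤ.* 0ℤ ≡ c ℤ.+ x ℤ.* (0ℤ ℤ.+ x ℤ.* 0ℤ)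
    lemma = ℤ-Solver.solve-∀
  eval-∷ʳ (a ∷ v) c x = cong (λ e → a ℤ.+ x ℤ.* e) (eval-∷ʳ v c x)

-- This lets polynomials of various smaller degrees be summed at one common degree, where they
-- contribute nothing to the leading coefficient.
poly-weaken : ∀ {d d′ c f} → d <′ d′ → IsPoly d c f → IsPoly d′ 0 f
poly-weaken <′-base     p = poly-suc p
poly-weaken (≤′-step lt) p = poly-suc (poly-weaken lt p)

poly-linear : ∀ {d c f} a b → IsPoly d c f → IsPoly (suc d) (a * c) (λ s → f s * (a * s + b))
poly-linear {c = c} {f} a b (v , f≡) = mulLinear (+ b) (+ a) v (+ c) , λ s → begin
  + (f s * (a * s + b))
    ≡⟨ ℤ.pos-* (f s) (a * s + b) ⟩
  + f s ℤ.* + (a * s + b)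
    ≡⟨ cong₂ ℤ._*_ (f≡ s) (trans (ℤ.pos-+ (a * s) b)
         (trans (cong (λ y → y ℤ.+ + b) (ℤ.pos-* a s)) (ℤ.+-comm (+ a ℤ.* + s) (+ b)))) ⟩
  eval (withLeading v (+ c)) (+ s) ℤ.* (+ b ℤ.+ + a ℤ.* + s)
    ≡⟨ ℤ.*-comm (eval (withLeading v (+ c)) (+ s)) _ ⟩
  (+ b ℤ.+ + a ℤ.* + s) ℤ.* eval (withLeading v (+ c)) (+ s)
    ≡⟨ eval-mulLinear (+ b) (+ a) v (+ c) (+ s) ⟨
  eval (withLeading (mulLinear (+ b) (+ a) v (+ c)) (+ a ℤ.* + c)) (+ s)
    ≡⟨ cong (λ l → eval (withLeading (mulLinear (+ b) (+ a) v (+ c)) l) (+ s)) (ℤ.pos-* a c) ⟨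
  eval (withLeading (mulLinear (+ b) (+ a) v (+ c)) (+ (a * c))) (+ s) ∎

poly-rising : ∀ {d c f} a b r → IsPoly d c f →
  IsPoly (r + d) (a ^ r * c) (λ s → f s * rising (a * s + b) r)
poly-rising {d} {c} {f} a b zero    p =
  poly-leading (sym (+-identityʳ c)) (poly-cong (λ s → sym (*-identityʳ (f s))) p)
poly-rising {d} {c} {f} a b (suc r) p =
  poly-leading (sym (*-assoc a (a ^ r) c))
    (poly-cong (λ s → lemma (f s) (rising (a * s + b) r) (a * s) b r)
      (poly-linear a (suc (r + b)) (poly-rising a b r p)))
  where
  lemma : ∀ f x y b r → f * x * (y + suc (r + b)) ≡ f * (x * suc (r + (y + b)))
  lemma = solve-∀

poly-doubling : ∀ {d c f} κ → IsPoly d c f → IsPoly (κ + d) (4 ^ κ * c) (λ s → f s * doubling s κ)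
poly-doubling {d} {c} {f} zero    p =
  poly-leading (sym (+-identityʳ c)) (poly-cong (λ s → sym (*-identityʳ (f s))) p)
poly-doubling {d} {c} {f} (suc κ) p =
  poly-leading (sym (*-assoc 4 (4 ^ κ) c))
    (poly-cong (λ s → *-assoc (f s) (doubling s κ) _)
      (poly-linear 4 (4 * κ + 2) (poly-doubling κ p)))

-- Normalised counts

-- s stands for n + 1, so that the normalised quantity can be evaluated at n = -1.
record Normalised (k d c : ℕ) (T : ℕ → ℕ) : Set where
  constructor normalised
  field
    ratio       : ℕ → ℕ
    ratio-poly  : IsPoly d c ratio
    ratio-eq    : ∀ s → s ! * k ! * (k + s) ! * T s ≡ ratio s * (2 * s) !

normalised-+ : ∀ {k d a b S T} → Normalised k d a S → Normalised k d b T →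
               Normalised k d (a + b) (λ s → S s + T s)
normalised-+ {k} {S = S} {T} (normalised f p f≡) (normalised g q g≡) =
  normalised (λ s → f s + g s) (poly-+ p q) λ s →
  trans (*-distribˡ-+ (s ! * k ! * (k + s) !) (S s) (T s))
    (trans (cong₂ _+_ (f≡ s) (g≡ s)) (sym (*-distribʳ-+ ((2 * s) !) (f s) (g s))))

normalised-zero : ∀ {k d T} → (∀ s → T s ≡ 0) → Normalised k d 0 T
normalised-zero {k} {d} T≡0 = normalised (λ _ → 0) (poly-zero d) λ s →
  trans (cong (s ! * k ! * (k + s) ! *_) (T≡0 s)) (*-zeroʳ (s ! * k ! * (k + s) !))
  where
  poly-zero : ∀ d → IsPoly d 0 (λ _ → 0)
  poly-zero zero    = poly-const 0
  poly-zero (suc d) = poly-suc (poly-zero d)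

-- Here B is a ballot number and N a binomial coefficient; u, w, M, z, y and κf stand
-- for (κ + s)!, (i + κ + s + 1)!, (i + 2 κ + 2 s)!, (2 (κ + s))!, (2 s)! and κ!.
cancel-factorials : ∀ sf {kf ksf} B N u w {M} b r z q y {c} κf rk rt .{{_ : NonZero u}} →
  B * (u * w) ≡ b * M → M ≡ r * z → sf * z ≡ q * y * u → N * κf ≡ c →
  kf ≡ rk * κf → ksf ≡ rt * w →
  sf * kf * ksf * (B * N) ≡ b * rk * q * r * rt * c * y
cancel-factorials sf B N u w b r z q y κf rk rt
  B≡ refl z≡ refl refl refl = *-cancelʳ-≡ _ _ u (begin
  sf * (rk * κf) * (rt * w) * (B * N) * u
    ≡⟨ lemma₁ sf rk κf rt w B N u ⟩
  sf * rk * rt * (N * κf) * (B * (u * w))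
    ≡⟨ cong (sf * rk * rt * (N * κf) *_) B≡ ⟩
  sf * rk * rt * (N * κf) * (b * (r * z))
    ≡⟨ lemma₂ sf rk rt (N * κf) b r z ⟩
  rk * rt * (N * κf) * b * r * (sf * z)
    ≡⟨ cong (rk * rt * (N * κf) * b * r *_) z≡ ⟩
  rk * rt * (N * κf) * b * r * (q * y * u)
    ≡⟨ lemma₃ rk rt (N * κf) b r q y u ⟩
  b * rk * q * r * rt * (N * κf) * y * u ∎)
  where
  lemma₁ : ∀ a b c d e f g h → a * (b * c) * (d * e) * (f * g) * h ≡ a * b * d * (g * c) * (f * (h * e))
  lemma₁ = solve-∀
  lemma₂ : ∀ a b c d e f g → a * b * c * d * (e * (f * g)) ≡ b * c * d * e * f * (a * g)
  lemma₂ = solve-∀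
  lemma₃ : ∀ a b c d e f g h → a * b * c * d * e * (f * g * h) ≡ d * a * f * e * b * c * g * h
  lemma₃ = solve-∀

-- The count from the wall point (i, 0), where the invariant forces i + 2 κ + 2 s steps, κ + s of
-- them raising i. With k = i + t + 1 + κ, `t` is the slack in i + κ < k: it makes the ballot
-- denominator (i + κ + s + 1)! divide (k + s)! with `t` linear factors left. The other factors have
-- degrees κ, i and κ.
halfPlane-normalised : ∀ i κ t {d} → i + t + κ + κ < d →
  Normalised (suc (i + t) + κ) d 0 (λ s → halfPlane (i + 2 * κ + 2 * s) i κ)
halfPlane-normalised i κ t {d} lt = normalised _
  (poly-weaken (<⇒<′ (subst (_< d) (degree i κ t) lt))
    (poly-cong (λ s → cong (_* rising (2 * s + (i + κ)) κ)
        (cong₂ (λ x y → suc i * rising κ (suc (i + t)) * doubling s κ * rising x i * rising y t)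
          (lemma₁ κ s) (lemma₂ i κ s)))
      (poly-rising 2 (i + κ) κ (poly-rising 1 (suc (i + κ)) t (poly-rising 2 (2 * κ) i
        (poly-doubling κ (poly-const (suc i * rising κ (suc (i + t))))))))))
  λ s → cancel-factorials (s !) (ballot (i + 2 * κ + 2 * s) i) ((i + 2 * κ + 2 * s) C κ)
    ((κ + s) !) (suc (i + (κ + s)) !)
    (suc i) (rising (2 * (κ + s)) i) ((2 * (κ + s)) !) (doubling s κ) ((2 * s) !) (κ !)
    (rising κ (suc (i + t))) (rising (suc (i + (κ + s))) t) {{(κ + s) !≢0}}
    (ballot-closed (i + 2 * κ + 2 * s) (κ + s) i (steps i κ s))
    (trans (cong _! (steps i κ s)) (rising-factorial (2 * (κ + s)) i))
    (doubling-factorial s κ)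
    (trans (cong (λ x → (x C κ) * κ !) (lemma₃ i κ s)) (choose-rising (2 * s + (i + κ)) κ))
    (rising-factorial κ (suc (i + t)))
    (trans (cong _! (lemma₄ i κ t s)) (rising-factorial (suc (i + (κ + s))) t))
  where
  degree : ∀ i κ t → i + t + κ + κ ≡ κ + (t + (i + (κ + 0)))
  degree = solve-∀
  lemma₁ : ∀ κ s → 2 * s + 2 * κ ≡ 2 * (κ + s)
  lemma₁ = solve-∀
  lemma₂ : ∀ i κ s → 1 * s + suc (i + κ) ≡ suc (i + (κ + s))
  lemma₂ = solve-∀
  lemma₃ : ∀ i κ s → i + 2 * κ + 2 * s ≡ 2 * s + (i + κ) + κ
  lemma₃ = solve-∀
  lemma₄ : ∀ i κ t s → suc (i + t) + κ + s ≡ t + suc (i + (κ + s))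
  lemma₄ = solve-∀
  steps : ∀ i κ s → i + 2 * κ + 2 * s ≡ i + 2 * (κ + s)
  steps = solve-∀

-- Here `suc k` is the k of the theorem. The ballot number is the Catalan number of k + s, and its
-- (k + s + 1)! and the (k + 1)! of the binomial cancel completely. There remain k factors of slope
-- 4 from `doubling`, and k + 1 factors of slope 2 from the binomial.
halfPlane-start-normalised : ∀ k →
  Normalised (suc k) (suc (2 * k)) (2 ^ (3 * k + 1)) (λ s → halfPlane (2 * k + 2 * s) 0 (suc k))
halfPlane-start-normalised k = normalised _
  (poly-leading (leading k) (poly-linear 2 k (poly-rising 2 k k (poly-doubling k (poly-const 1)))))
  λ s → trans (cancel-factorials (s !) (ballot (2 * k + 2 * s) 0) ((2 * k + 2 * s) C suc k)
    ((k + s) !) (suc (k + s) !) 1 1 ((2 * (k + s)) !) (doubling s k) ((2 * s) !) (suc k !) 1 1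
    {{(k + s) !≢0}}
    (ballot-closed (2 * k + 2 * s) (k + s) 0 (sym (*-distribˡ-+ 2 k s)))
    (trans (cong _! (sym (*-distribˡ-+ 2 k s))) (sym (+-identityʳ _)))
    (doubling-factorial s k)
    (trans (cong (λ x → (x C suc k) * suc k !) (lemma₁ k s)) (choose-rising-suc (2 * s + k) k))
    (sym (+-identityʳ _))
    (sym (+-identityʳ _)))
    (lemma₂ (doubling s k) (rising (2 * s + k) k) (2 * s + k) ((2 * s) !))
  where
  leading : ∀ k → 2 * (2 ^ k * (4 ^ k * 1)) ≡ 2 ^ (3 * k + 1)
  leading k = begin
    2 * (2 ^ k * (4 ^ k * 1))
      ≡⟨ cong (λ x → 2 * (2 ^ k * (x * 1))) (^-*-assoc 2 2 k) ⟩
    2 * (2 ^ k * (2 ^ (2 * k) * 1))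
      ≡⟨ cong (λ x → 2 * (2 ^ k * x)) (*-identityʳ (2 ^ (2 * k))) ⟩
    2 * (2 ^ k * 2 ^ (2 * k))
      ≡⟨ cong (2 *_) (^-distribˡ-+-* 2 k (2 * k)) ⟨
    2 ^ suc (k + 2 * k)
      ≡⟨ cong (2 ^_) (+-comm 1 (3 * k)) ⟩
    2 ^ (3 * k + 1) ∎
  lemma₁ : ∀ k s → 2 * k + 2 * s ≡ 2 * s + k + k
  lemma₁ = solve-∀
  lemma₂ : ∀ a b c y → 1 * 1 * a * 1 * 1 * (b * c) * y ≡ 1 * a * b * c * y
  lemma₂ = solve-∀

-- Induction on `ℓ`, the number of steps left less 2 s, so that the recursion is the same for all s.
-- The equation is the invariant of `walks`. No step increases i + κ - y, so the inequality persists
-- and becomes i + κ ≤ K on the wall, as the half-plane count there requires.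
hitting-normalised : ∀ K ℓ i y κ → ℓ + 2 * y ≡ i + 2 * κ → i + κ ≤ K + y →
  Normalised (suc K) (suc (2 * K)) 0 (λ s → hitting (ℓ + 2 * s) i y κ)
hitting-normalised K ℓ i zero κ eq le = wall (m≤n⇒∃[o]m+o≡n le)
  where
  wall : Σ ℕ (λ t → i + κ + t ≡ K + 0) →
    Normalised (suc K) (suc (2 * K)) 0 (λ s → halfPlane (ℓ + 2 * s) i κ)
  wall (t , i+κ+t≡K) = subst₂
    (λ ℓ K → Normalised (suc K) (suc (2 * K)) 0 (λ s → halfPlane (ℓ + 2 * s) i κ))
    (trans (sym eq) (+-identityʳ ℓ))
    (trans (lemma₁ i κ t) (trans i+κ+t≡K (+-identityʳ K)))
    (halfPlane-normalised i κ t
      (s≤s (≤-trans (m≤m+n _ (i + t)) (≤-reflexive (lemma₂ (i + t) κ)))))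
    where
    lemma₁ : ∀ i κ t → i + t + κ ≡ i + κ + t
    lemma₁ = solve-∀
    lemma₂ : ∀ a b → a + b + b + a ≡ 2 * (a + b)
    lemma₂ = solve-∀
-- Although 2 s steps are left, the wall is out of reach: i + 2 κ is twice the height, hence less
-- than three times the height.
hitting-normalised K zero i (suc y) κ eq le = normalised-zero λ s →
  hitting-zero (2 * s) i (suc y) κ (subst (_< 3 * suc y) eq (*-monoˡ-< (suc y) {2} {3} ≤-refl))
hitting-normalised K (suc ℓ) i (suc y) κ eq le =
  normalised-+ (normalised-+ goNorthEast (goWest i eq le)) (consume κ eq le)
  where
  Hits : ℕ → ℕ → ℕ → Set
  Hits i y κ = Normalised (suc K) (suc (2 * K)) 0 (λ s → hitting (ℓ + 2 * s) i y κ)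
  goNorthEast : Hits (suc i) (2 + y) κ
  goNorthEast = hitting-normalised K ℓ (suc i) (2 + y) κ
    (trans (lemma ℓ y) (cong suc eq)) (subst (suc (i + κ) ≤_) (sym (+-suc K (suc y))) (s≤s le))
    where
    lemma : ∀ ℓ y → ℓ + 2 * (2 + y) ≡ suc (suc ℓ + 2 * suc y)
    lemma = solve-∀
  goWest : ∀ i → suc ℓ + 2 * suc y ≡ i + 2 * κ → i + κ ≤ K + suc y →
    Normalised (suc K) (suc (2 * K)) 0 (λ s → before (λ i′ → hitting (ℓ + 2 * s) i′ (suc y) κ) i)
  goWest zero    eq le = normalised-zero λ _ → refl
  goWest (suc i) eq le = hitting-normalised K ℓ i (suc y) κ (suc-injective eq) (≤-trans (n≤1+n _) le)
  goSouthWest : ∀ i κ → suc ℓ + 2 * suc y ≡ i + 2 * suc κ → i + suc κ ≤ K + suc y →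
    Normalised (suc K) (suc (2 * K)) 0 (λ s → before (λ i′ → hitting (ℓ + 2 * s) i′ y κ) i)
  goSouthWest zero    κ eq le = normalised-zero λ _ → refl
  goSouthWest (suc i) κ eq le = hitting-normalised K ℓ i y κ
    (+-cancelˡ-≡ 3 _ _ (trans (lemma ℓ y) (trans eq (sym (lemma i κ)))))
    (≤-trans (n≤1+n (i + κ)) (s≤s⁻¹ (subst₂ _≤_ (cong suc (+-suc i κ)) (+-suc K y) le)))
    where
    lemma : ∀ ℓ y → 3 + (ℓ + 2 * y) ≡ suc ℓ + 2 * suc y
    lemma = solve-∀
  consume : ∀ κ → suc ℓ + 2 * suc y ≡ i + 2 * κ → i + κ ≤ K + suc y →
    Normalised (suc K) (suc (2 * K)) 0 (λ s → before (λ κ′ → hitting (ℓ + 2 * s) (suc i) (suc y) κ′ +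
      before (λ i′ → hitting (ℓ + 2 * s) i′ y κ′) i) κ)
  consume zero    eq le = normalised-zero λ _ → refl
  consume (suc κ) eq le = normalised-+
    (hitting-normalised K ℓ (suc i) (suc y) κ (suc-injective (trans eq (lemma i κ)))
      (subst (_≤ K + suc y) (+-suc i κ) le))
    (goSouthWest i κ eq le)
    where
    lemma : ∀ i κ → i + 2 * suc κ ≡ suc (suc i + 2 * κ)
    lemma = solve-∀

-- Gessel walks

length-filter-map : ∀ {A B : Set} {P : Pred B 0ℓ} {Q : Pred A 0ℓ} (P? : Decidable P) (Q? : Decidable Q)
  (f : A → B) → (∀ x → P (f x) → Q x) → (∀ x → Q x → P (f x)) →
  ∀ xs → length (filter P? (map f xs)) ≡ length (filter Q? xs)
length-filter-map P? Q? f to from []       = refl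
length-filter-map P? Q? f to from (x ∷ xs) with P? (f x) | Q? x
... | yes p | yes q = cong suc (length-filter-map P? Q? f to from xs)
... | yes p | no ¬q = contradiction (to x p) ¬q
... | no ¬p | yes q = contradiction (from x q) ¬p
... | no ¬p | no ¬q = length-filter-map P? Q? f to from xs

WalkFrom : Point → Point → ∀ {m} → Vec Step m → Set
WalkFrom p q w = All InQuadrant (visited p w) × endpoint p w ≡ q

walkFrom? : ∀ p q {m} (w : Vec Step m) → Dec (WalkFrom p q w)
walkFrom? p q w = all? inQuadrant? (visited p w) ×-dec ≡-dec ℤ._≟_ ℤ._≟_ (endpoint p w) q

-- An arbitrary start allows recursion on the first step; at `origin` this is `F` by computation.
count : ℕ → Point → Point → ℕ
count m p q = length (filter (walkFrom? p q) (stepSequences m))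

visited-start : ∀ {m} p (w : Vec Step m) → All InQuadrant (visited p w) → InQuadrant p
visited-start p []      (p∈ ∷ _) = p∈
visited-start p (_ ∷ _) (p∈ ∷ _) = p∈

count-outside : ∀ m {p} q → ¬ InQuadrant p → count m p q ≡ 0
count-outside m {p} q p∉ = cong length (filter-none (walkFrom? p q)
  (All.universal (λ w (stays , _) → p∉ (visited-start p w stays)) (stepSequences m)))

count-0 : ∀ p q → ¬ p ≡ q → count 0 p q ≡ 0
count-0 p q p≢q = cong length (filter-none (walkFrom? p q) (All.universal (λ { [] (_ , eq) → p≢q eq }) (stepSequences 0)))

count-suc : ∀ m p q → InQuadrant p → count (suc m) p q ≡
  count m (p ⊕ step west) q + (count m (p ⊕ step northEast) q +
  (count m (p ⊕ step east) q + (count m (p ⊕ step southWest) q + 0)))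
count-suc m p q p∈ =
  first west _ (first northEast _ (first east _ (first southWest _ refl)))
  where
  first : ∀ s ws {c} → length (filter (walkFrom? p q) ws) ≡ c →
    length (filter (walkFrom? p q) (map (s ∷_) (stepSequences m) ++ ws)) ≡ count m (p ⊕ step s) q + c
  first s ws refl = trans
    (cong length (filter-++ (walkFrom? p q) (map (s ∷_) (stepSequences m)) ws))
    (trans (length-++ (filter (walkFrom? p q) (map (s ∷_) (stepSequences m))))
      (cong (_+ length (filter (walkFrom? p q) ws))
        (length-filter-map (walkFrom? p q) (walkFrom? (p ⊕ step s) q) (s ∷_)
          (λ { w (_ ∷ stays , ends) → stays , ends })
          (λ { w (stays , ends) → p∈ ∷ stays , ends })
          (stepSequences m))))

-- The four first steps are put in the order of `advance`; those that leave the quadrant become the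
-- zero default of `before`.
count-advance : ∀ m i j q → count (suc m) (+ i , + j) q ≡
  count m (+ suc i , + suc j) q + before (λ i′ → count m (+ i′ , + j) q) i +
  (count m (+ suc i , + j) q + before (λ i′ → before (λ j′ → count m (+ i′ , + j′) q) j) i)
count-advance m i j q = trans (count-suc m (+ i , + j) q (ℤ.+≤+ z≤n , ℤ.+≤+ z≤n))
  (trans (cong₂ _+_ (goWest i) (cong₂ _+_ (goNorthEast) (cong₂ _+_ goEast (cong (_+ 0) (goSouthWest i j)))))
    (lemma (before (λ i′ → count m (+ i′ , + j) q) i) (count m (+ suc i , + suc j) q)
           (count m (+ suc i , + j) q) _))
  where
  lemma : ∀ w x y z → w + (x + (y + (z + 0))) ≡ x + w + (y + z)
  lemma = solve-∀
  goNorthEast : count m (+ (i + 1) , + (j + 1)) q ≡ count m (+ suc i , + suc j) q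
  goNorthEast = cong₂ (λ x y → count m (+ x , + y) q) (+-comm i 1) (+-comm j 1)
  goEast : count m (+ (i + 1) , + (j + 0)) q ≡ count m (+ suc i , + j) q
  goEast = cong₂ (λ x y → count m (+ x , + y) q) (+-comm i 1) (+-identityʳ j)
  goWest : ∀ i → count m ((+ i , + j) ⊕ step west) q ≡ before (λ i′ → count m (+ i′ , + j) q) i
  goWest zero    = count-outside m q λ { (() , _) }
  goWest (suc i) = cong (λ y → count m (+ i , + y) q) (+-identityʳ j)
  goSouthWest : ∀ i j → count m ((+ i , + j) ⊕ step southWest) q ≡
    before (λ i′ → before (λ j′ → count m (+ i′ , + j′) q) j) i
  goSouthWest zero    j       = count-outside m q λ { (() , _) }
  goSouthWest (suc i) zero    = count-outside m q λ { (_ , ()) }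
  goSouthWest (suc i) (suc j) = refl

-- Reaching (0, n) from (i, j) takes at least 2 (n - j) + i steps.
count-far : ∀ m i j n → m + 2 * j < 2 * n + i → count m (+ i , + j) (0ℤ , + n) ≡ 0
count-far zero    i j n lt = count-0 (+ i , + j) (0ℤ , + n) λ { refl → <-irrefl (sym (+-identityʳ (2 * n))) lt }
count-far (suc m) i j n lt = trans (count-advance m i j _) (cong₂ _+_
  (cong₂ _+_
    (count-far m (suc i) (suc j) n (subst₂ _<_ (lemma₁ m j) (sym (+-suc (2 * n) i)) (s≤s lt)))
    (goWest i lt))
  (cong₂ _+_
    (count-far m (suc i) j n (<-trans (n<1+n _) (<-trans lt (≤-reflexive (sym (+-suc (2 * n) i))))))
    (goSouthWest i j lt)))
  where
  lemma₁ : ∀ m j → suc (suc m + 2 * j) ≡ m + 2 * suc j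
  lemma₁ = solve-∀
  goWest : ∀ i → suc m + 2 * j < 2 * n + i → before (λ i′ → count m (+ i′ , + j) (0ℤ , + n)) i ≡ 0
  goWest zero    lt = refl
  goWest (suc i) lt = count-far m i j n (s≤s⁻¹ (subst (suc (suc m + 2 * j) ≤_) (+-suc (2 * n) i) lt))
  goSouthWest : ∀ i j → suc m + 2 * j < 2 * n + i →
    before (λ i′ → before (λ j′ → count m (+ i′ , + j′) (0ℤ , + n)) j) i ≡ 0
  goSouthWest zero    j       lt = refl
  goSouthWest (suc i) zero    lt = refl
  goSouthWest (suc i) (suc j) lt = count-far m i j n (<-trans
    (≤-trans (n≤1+n _) (≤-reflexive (lemma₁ m j)))
    (s≤s⁻¹ (subst (suc (suc m + 2 * suc j) ≤_) (+-suc (2 * n) i) lt)))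

-- The endpoints and the length fix the number of East and South-West steps, so prescribing `κ`
-- loses no walk. The hypothesis is the invariant of `walks` with y = j + 1 and s = n + 1.
count≡avoiding : ∀ m i j κ n → m + 2 * j ≡ 2 * n + i + 2 * κ →
  count m (+ i , + j) (0ℤ , + n) ≡ avoiding m i (suc j) κ
count≡avoiding zero    zero    j zero n eq
  rewrite *-cancelˡ-≡ j n 2 (trans eq (trans (+-identityʳ _) (+-identityʳ _))) =
  cong length (filter-accept (walkFrom? (0ℤ , + n) (0ℤ , + n)) {[]} {[]}
    (((ℤ.+≤+ z≤n , ℤ.+≤+ z≤n) ∷ []) , refl))
count≡avoiding zero    zero    j (suc κ) n eq = count-0 (0ℤ , + j) (0ℤ , + n) λ { refl →
  <-irrefl eq (subst (2 * n <_) (cong (_+ 2 * suc κ) (sym (+-identityʳ (2 * n)))) (m<m+n (2 * n) z<s)) }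
count≡avoiding zero    (suc i) j κ n eq = count-0 (+ suc i , + j) (0ℤ , + n) λ ()
count≡avoiding (suc m) i j κ n eq = trans (count-advance m i j _) (cong₂ _+_
  (cong₂ _+_
    (count≡avoiding m (suc i) (suc j) κ n (trans (sym (lemma₁ m j)) (trans (cong suc eq) (lemma₂ n i κ))))
    (goWest i eq))
  (consume κ eq))
  where
  lemma₁ : ∀ m j → suc (suc m + 2 * j) ≡ m + 2 * suc j
  lemma₁ = solve-∀
  lemma₂ : ∀ n i κ → suc (2 * n + i + 2 * κ) ≡ 2 * n + suc i + 2 * κ
  lemma₂ = solve-∀
  goWest : ∀ i → suc m + 2 * j ≡ 2 * n + i + 2 * κ →
    before (λ i′ → count m (+ i′ , + j) (0ℤ , + n)) i ≡ before (λ i′ → avoiding m i′ (suc j) κ) i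
  goWest zero    eq = refl
  goWest (suc i) eq = count≡avoiding m i j κ n (suc-injective (trans eq (sym (lemma₂ n i κ))))
  goSouthWest : ∀ i j κ → suc m + 2 * j ≡ 2 * n + i + 2 * suc κ →
    before (λ i′ → before (λ j′ → count m (+ i′ , + j′) (0ℤ , + n)) j) i ≡
    before (λ i′ → avoiding m i′ j κ) i
  goSouthWest zero    j       κ eq = refl
  -- The step leaves the quadrant on the left and lands on the wall on the right, so both sides are
  -- 0.
  goSouthWest (suc i) zero    κ eq = refl
  goSouthWest (suc i) (suc j) κ eq = count≡avoiding m i j κ n
    (+-cancelˡ-≡ 3 _ _ (trans (lemma₃ m j) (trans eq (lemma₄ n i κ))))
    where
    lemma₃ : ∀ m j → 3 + (m + 2 * j) ≡ suc m + 2 * suc j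
    lemma₃ = solve-∀
    lemma₄ : ∀ n i κ → 2 * n + suc i + 2 * suc κ ≡ 3 + (2 * n + i + 2 * κ)
    lemma₄ = solve-∀
  consume : ∀ κ → suc m + 2 * j ≡ 2 * n + i + 2 * κ →
    count m (+ suc i , + j) (0ℤ , + n) +
      before (λ i′ → before (λ j′ → count m (+ i′ , + j′) (0ℤ , + n)) j) i ≡
    before (λ κ′ → avoiding m (suc i) (suc j) κ′ + before (λ i′ → avoiding m i′ j κ′) i) κ
  -- With `κ = 0` the right side admits no East or South-West step; on the left, such a step leaves
  -- the goal too far away for the remaining `m` steps.
  consume zero    eq = cong₂ _+_
    (count-far m (suc i) j n (subst₂ _<_ refl (sym (+-suc (2 * n) i)) (m≤n⇒m≤1+n m+2j<2n+i)))
    (far i j m+2j<2n+i)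
    where
    m+2j<2n+i : m + 2 * j < 2 * n + i
    m+2j<2n+i = ≤-reflexive (trans eq (+-identityʳ (2 * n + i)))
    far : ∀ i j → m + 2 * j < 2 * n + i →
      before (λ i′ → before (λ j′ → count m (+ i′ , + j′) (0ℤ , + n)) j) i ≡ 0
    far zero    j       lt = refl
    far (suc i) zero    lt = refl
    far (suc i) (suc j) lt = count-far m i j n (≤-trans (n≤1+n _)
      (subst (_≤ 2 * n + i) (sym (lemma₁ m j))
        (s≤s⁻¹ (subst (m + 2 * suc j <_) (+-suc (2 * n) i) lt))))
  consume (suc κ) eq = cong₂ _+_
    (count≡avoiding m (suc i) j κ n (suc-injective (trans eq (lemma₃ n i κ))))
    (goSouthWest i j κ eq)
    where
    lemma₃ : ∀ n i κ → 2 * n + i + 2 * suc κ ≡ suc (2 * n + suc i + 2 * κ)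
    lemma₃ = solve-∀

-- Subtraction, division by n + 1 and the final polynomial

normalised-difference : ∀ {k d c} (R S T : ℕ → ℕ) → Normalised k d c S → Normalised k d 0 T →
  (∀ s → R s + T s ≡ S s) → Σ (Vec ℤ d) λ v → ∀ s →
  + (s ! * k ! * (k + s) ! * R s) ≡ eval (withLeading v (+ c)) (+ s) ℤ.* + ((2 * s) !)
normalised-difference {k} {c = c} R S T
  (normalised f (v , f≡) fS) (normalised g (w , g≡) gT) R+T≡S =
  zipWith ℤ._-_ v w , λ s → begin
    + (N s * R s)
      ≡⟨ lemma₁ (+ (N s * R s)) (+ (N s * T s)) ⟩
    (+ (N s * R s) ℤ.+ + (N s * T s)) ℤ.- + (N s * T s)
      ≡⟨ cong (λ x → x ℤ.- + (N s * T s)) (ℤ.pos-+ (N s * R s) (N s * T s)) ⟨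
    + (N s * R s + N s * T s) ℤ.- + (N s * T s)
      ≡⟨ cong₂ (λ x y → + x ℤ.- + y)
           (trans (sym (*-distribˡ-+ (N s) (R s) (T s))) (trans (cong (N s *_) (R+T≡S s)) (fS s)))
           (gT s) ⟩
    + (f s * (2 * s) !) ℤ.- + (g s * (2 * s) !)
      ≡⟨ cong₂ ℤ._-_ (ℤ.pos-* (f s) ((2 * s) !)) (ℤ.pos-* (g s) ((2 * s) !)) ⟩
    + f s ℤ.* + ((2 * s) !) ℤ.- + g s ℤ.* + ((2 * s) !)
      ≡⟨ lemma₂ (+ f s) (+ g s) (+ ((2 * s) !)) ⟩
    (+ f s ℤ.- + g s) ℤ.* + ((2 * s) !)
      ≡⟨ cong (ℤ._* + ((2 * s) !)) (trans (cong₂ ℤ._-_ (f≡ s) (g≡ s)) (sym (eval-- v w (+ s)))) ⟩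
    eval (withLeading (zipWith ℤ._-_ v w) (+ c)) (+ s) ℤ.* + ((2 * s) !) ∎
  where
  N : ℕ → ℕ
  N s = s ! * k ! * (k + s) !
  lemma₁ : ∀ a b → a ≡ a ℤ.+ b ℤ.- b
  lemma₁ = ℤ-Solver.solve-∀
  lemma₂ : ∀ a b c → a ℤ.* c ℤ.- b ℤ.* c ≡ (a ℤ.- b) ℤ.* c
  lemma₂ = ℤ-Solver.solve-∀
  eval-- : ∀ {d c} (v w : Vec ℤ d) x → eval (withLeading (zipWith ℤ._-_ v w) c) x ≡
           eval (withLeading v c) x ℤ.- eval (withLeading w 0ℤ) x
  eval-- {c = c} [] [] x = lemma c x
    where
    lemma : ∀ c x → c ℤ.+ x ℤ.* 0ℤ ≡ c ℤ.+ x ℤ.* 0ℤ ℤ.- (0ℤ ℤ.+ x ℤ.* 0ℤ)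
    lemma = ℤ-Solver.solve-∀
  eval-- (a ∷ v) (b ∷ w) x = trans (cong (λ e → a ℤ.- b ℤ.+ x ℤ.* e) (eval-- v w x)) (lemma a b x _ _)
    where
    lemma : ∀ a b x e f → a ℤ.- b ℤ.+ x ℤ.* (e ℤ.- f) ≡ a ℤ.+ x ℤ.* e ℤ.- (b ℤ.+ x ℤ.* f)
    lemma = ℤ-Solver.solve-∀

-- In the unnormalised rationals the equality is cross-multiplication, which is the hypothesis.
/-*-integer : ∀ x y f e .{{_ : NonZero y}} → x ℤ.* f ≡ e ℤ.* + y → (x / y) ℚ.* (f / 1) ≡ e / 1
/-*-integer x (suc y) f e eq = ℚ.toℚᵘ-injective
  (ℚᵘ.≃-trans (ℚ.toℚᵘ-homo-* (x / suc y) (f / 1))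
  (ℚᵘ.≃-trans (ℚᵘ.*-cong (ℚ.toℚᵘ-fromℚᵘ (ℚᵘ.mkℚᵘ x y)) (ℚ.toℚᵘ-fromℚᵘ (ℚᵘ.mkℚᵘ f 0)))
  (ℚᵘ.≃-trans (ℚᵘ.*≡* (trans (ℤ.*-identityʳ (x ℤ.* f))
                        (trans eq (cong (λ z → e ℤ.* + suc z) (sym (*-identityʳ y))))))
    (ℚᵘ.≃-sym (ℚ.toℚᵘ-fromℚᵘ (ℚᵘ.mkℚᵘ e 0))))))

F≡avoiding : ∀ k n → F (2 * n + 2 * suc k) 0ℤ (+ n) ≡ avoiding (2 * k + 2 * suc n) 0 1 (suc k)
F≡avoiding k n = trans
  (count≡avoiding (2 * n + 2 * suc k) 0 0 (suc k) n (lemma₁ n k))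
  (cong (λ m → avoiding m 0 1 (suc k)) (lemma₂ n k))
  where
  lemma₁ : ∀ n k → 2 * n + 2 * suc k + 2 * 0 ≡ 2 * n + 0 + 2 * suc k
  lemma₁ = solve-∀
  lemma₂ : ∀ n k → 2 * n + 2 * suc k ≡ 2 * k + 2 * suc n
  lemma₂ = solve-∀

-- Evaluation at s = 0 shows that the constant coefficient is 0, so the polynomial is s q(s).
-- Cancelling s = n + 1 leaves q(n + 1), a polynomial in n with the same top coefficient and degree
-- one lower.
divide-translate : ∀ {d} c (N M D : ℕ → ℕ) → N 0 ≡ 0 → D 0 ≡ 1 → (∀ n → N (suc n) ≡ suc n * M n) →
  Σ (Vec ℤ (suc d)) (λ v → ∀ s → + N s ≡ eval (withLeading v c) (+ s) ℤ.* + D s) →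
  Σ (Vec ℤ d) (λ v → ∀ n → + M n ≡ eval (withLeading v c) (+ n) ℤ.* + D (suc n))
divide-translate c N M D N0≡0 D0≡1 N≡ (a ∷ v , eq) = translate v c , λ n →
  ℤ.*-cancelˡ-≡ (+ suc n) _ _ (begin
    + suc n ℤ.* + M n
      ≡⟨ ℤ.pos-* (suc n) (M n) ⟨
    + (suc n * M n)
      ≡⟨ cong +_ (N≡ n) ⟨
    + N (suc n)
      ≡⟨ eq (suc n) ⟩
    (a ℤ.+ + suc n ℤ.* eval (withLeading v c) (+ suc n)) ℤ.* + D (suc n)
      ≡⟨ cong (λ a → (a ℤ.+ + suc n ℤ.* eval (withLeading v c) (+ suc n)) ℤ.* + D (suc n)) a≡0 ⟩
    (0ℤ ℤ.+ + suc n ℤ.* eval (withLeading v c) (+ suc n)) ℤ.* + D (suc n)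
      ≡⟨ lemma₂ (+ suc n) (eval (withLeading v c) (+ suc n)) (+ D (suc n)) ⟩
    + suc n ℤ.* (eval (withLeading v c) (+ suc n) ℤ.* + D (suc n))
      ≡⟨ cong (λ e → + suc n ℤ.* (e ℤ.* + D (suc n))) (eval-translate v c (+ n)) ⟨
    + suc n ℤ.* (eval (withLeading (translate v c) c) (+ n) ℤ.* + D (suc n)) ∎)
  where
  lemma₁ : ∀ a e → a ≡ (a ℤ.+ 0ℤ ℤ.* e) ℤ.* 1ℤ
  lemma₁ = ℤ-Solver.solve-∀
  lemma₂ : ∀ x e y → (0ℤ ℤ.+ x ℤ.* e) ℤ.* y ≡ x ℤ.* (e ℤ.* y)
  lemma₂ = ℤ-Solver.solve-∀
  a≡0 : a ≡ 0ℤ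
  a≡0 = begin
    a
      ≡⟨ lemma₁ a (eval (withLeading v c) 0ℤ) ⟩
    (a ℤ.+ 0ℤ ℤ.* eval (withLeading v c) 0ℤ) ℤ.* 1ℤ
      ≡⟨ cong (λ D → (a ℤ.+ 0ℤ ℤ.* eval (withLeading v c) 0ℤ) ℤ.* + D) D0≡1 ⟨
    (a ℤ.+ 0ℤ ℤ.* eval (withLeading v c) 0ℤ) ℤ.* + D 0
      ≡⟨ eq 0 ⟨
    + N 0
      ≡⟨ cong +_ N0≡0 ⟩
    0ℤ ∎

AvoidingRatio : ∀ k → Vec ℤ (2 * k) → Set
AvoidingRatio k v = ∀ n →
  + (n ! * suc k ! * (suc k + suc n) ! * avoiding (2 * k + 2 * suc n) 0 1 (suc k)) ≡
  eval (withLeading v (+ (2 ^ (3 * k + 1)))) (+ n) ℤ.* + ((2 * suc n) !)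

avoiding-polynomial : ∀ k → Σ (Vec ℤ (2 * k)) (AvoidingRatio k)
avoiding-polynomial k = divide-translate (+ (2 ^ (3 * k + 1)))
  (λ s → s ! * suc k ! * (suc k + s) ! * A s)
  (λ n → n ! * suc k ! * (suc k + suc n) ! * A (suc n))
  (λ s → (2 * s) !)
  (trans (cong (0 ! * suc k ! * (suc k + 0) ! *_) A0≡0) (*-zeroʳ (0 ! * suc k ! * (suc k + 0) !)))
  refl
  (λ n → lemma₂ (suc n) (n !) (suc k !) ((suc k + suc n) !) (A (suc n)))
  (normalised-difference A
    (λ s → halfPlane (2 * k + 2 * s) 0 (suc k)) (λ s → hitting (2 * k + 2 * s) 0 1 (suc k))
    (halfPlane-start-normalised k)
    -- The start (0, 1) meets both hypotheses, the inequality with equality.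
    (hitting-normalised k (2 * k) 0 1 (suc k) (lemma₃ k) (≤-reflexive (+-comm 1 k)))
    (λ s → avoiding+hitting (2 * k + 2 * s) 0 1 (suc k)))
  where
  A : ℕ → ℕ
  A s = avoiding (2 * k + 2 * s) 0 1 (suc k)
  lemma₁ : ∀ k → 2 * k + 2 * 0 + 2 * 1 ≡ 0 + 2 * suc k
  lemma₁ = solve-∀
  lemma₂ : ∀ x a b c d → x * a * b * c * d ≡ x * (a * b * c * d)
  lemma₂ = solve-∀
  lemma₃ : ∀ k → 2 * k + 2 * 1 ≡ 0 + 2 * suc k
  lemma₃ = solve-∀
  -- At s = 0 no Gessel walk is meant; the recurrence still makes sense, with its goal on the wall.
  A0≡0 : A 0 ≡ 0
  A0≡0 = avoiding-zero (2 * k + 2 * 0) 0 1 (suc k) (≤-reflexive (lemma₁ k))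

quantity-integer : ∀ k n e →
  + (n ! * k ! * (n + k + 1) ! * F (2 * n + 2 * k) 0ℤ (+ n)) ≡ e ℤ.* + ((2 * n + 2) !) →
  quantity k n ≡ e / 1
quantity-integer k n e eq = /-*-integer (+ (n ! * k ! * (n + k + 1) !)) ((2 * n + 2) !)
  (+ F (2 * n + 2 * k) 0ℤ (+ n)) e {{(2 * n + 2) !≢0}}
  (trans (sym (ℤ.pos-* (n ! * k ! * (n + k + 1) !) (F (2 * n + 2 * k) 0ℤ (+ n)))) eq)

hasLeadingTerm : ∀ {d} (v : Vec ℤ d) e → HasLeadingTerm (withLeading v (+ (2 ^ e))) (+ (2 ^ e)) d
hasLeadingTerm v e =
    coeff-leading v _
  , (λ c≡0 → ≢-nonZero⁻¹ (2 ^ e) {{m^n≢0 2 e}} (ℤ.+-injective c≡0))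
  , coeff-above v _

mainTheorem7 : (k : ℕ) → 1 ≤ k →
    Σ Polynomial (λ p →
    ((n : ℕ) → quantity k n ≡ eval p (+ n) / 1)
    × HasLeadingTerm p (+ (2 ^ (3 * k ∸ 2))) (2 * k ∸ 2))
mainTheorem7 (suc k) _ = polynomial (avoiding-polynomial k)
  where
  lemma₁ : ∀ k n → n + suc k + 1 ≡ suc k + suc n
  lemma₁ = solve-∀
  lemma₂ : ∀ n → 2 * suc n ≡ 2 * n + 2
  lemma₂ = solve-∀
  lemma₃ : ∀ k → 3 * suc k ≡ 2 + (3 * k + 1)
  lemma₃ = solve-∀
  lemma₄ : ∀ k → 2 * suc k ≡ 2 + 2 * k
  lemma₄ = solve-∀
  polynomial : Σ (Vec ℤ (2 * k)) (AvoidingRatio k) →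
    Σ Polynomial (λ p →
    ((n : ℕ) → quantity (suc k) n ≡ eval p (+ n) / 1)
    × HasLeadingTerm p (+ (2 ^ (3 * suc k ∸ 2))) (2 * suc k ∸ 2))
  polynomial (v , v≡) = p , (λ n → quantity-integer (suc k) n (eval p (+ n)) (cleared n)) , leading
    where
    p : Polynomial
    p = withLeading v (+ (2 ^ (3 * k + 1)))
    cleared : ∀ n → + (n ! * suc k ! * (n + suc k + 1) ! * F (2 * n + 2 * suc k) 0ℤ (+ n)) ≡
              eval p (+ n) ℤ.* + ((2 * n + 2) !)
    cleared n = trans
      (cong₂ (λ x f → + (n ! * suc k ! * x ! * f)) (lemma₁ k n) (F≡avoiding k n))
      (trans (v≡ n) (cong (λ x → eval p (+ n) ℤ.* + (x !)) (lemma₂ n)))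
    leading : HasLeadingTerm p (+ (2 ^ (3 * suc k ∸ 2))) (2 * suc k ∸ 2)
    leading = subst₂ (λ e d → HasLeadingTerm p (+ (2 ^ e)) d)
      (sym (cong (_∸ 2) (lemma₃ k))) (sym (cong (_∸ 2) (lemma₄ k)))
      (hasLeadingTerm v (3 * k + 1))
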